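{- Realizability is not definable in monadic second-order logic for weighted graphs without the linear order. That is: there is a bound $M\in\mathbb{N}$ such that no $\mathsf{MSO}$ sentence $\varphi$ over the signature consisting of the binary relations $E_\gamma$, $\gamma\in\Gamma_M$, satisfies, for all finite weighted graphs $G\in\mathcal{G}(\emptyset,\Gamma_M)$ whose order is not required to be linear, $G\models\varphi \iff G$ is realizable.
   Context: $\Gamma_M=\{\mathsf{succ}\}\cup(\{<,\le\}\times\{ -(M-1),\dots,0,\dots,M-1\})$. A weighted graph in $\mathcal{G}(\emptyset,\Gamma_M)$ is $G=(V,E)$ with $V$ finite and $E\subseteq V\times\Gamma_M\times V$; $E_\gamma=\{(u,v):(u,\gamma,v)\in E\}$. It is viewed as a relational structure with universe $V$ and binary relations $E_\gamma$, $\gamma\in\Gamma_M$; $\mathsf{MSO}$ has quantification over vertices and sets of vertices. Here $E_{\mathsf{succ}}$ is only assumed acyclic, so that its reflexive-transitive closure $\preceq$ is a partial order on $V$ which need not be total. $G$ is realizable if there is $\mathsf{ts}:V\to\mathbb{R}$ such that (i) $\mathsf{ts}(v)-\mathsf{ts}(u)\triangleleft\alpha$ for every edge $(u,\triangleleft,\alpha,v)\in E$ with $\triangleleft\in\{<,\le\}$, and (ii) $u\preceq v$ implies $\mathsf{ts}(u)\le\mathsf{ts}(v)$. -}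

module Defs where

open import Algebra.Bundles using (CommutativeMonoid)
import Algebra.Properties.CommutativeSemigroup as CommutativeSemigroupProperties
open import Data.Bool.Base using (Bool; T)
open import Data.Fin.Base using (Fin)
open import Data.Fin.Subset using (Subset; _∈_)
open import Data.Integer.Base as ℤ using (ℤ)
open import Data.Nat.Base as ℕ using (ℕ; suc; _⊔_)
import Data.Nat.Properties as ℕ
open import Data.Product.Base using (Σ-syntax; ∃-syntax; _×_; _,_)
open import Data.Rational.Base as ℚ using (ℚ; 0ℚ; ½; ∣_∣)
import Data.Rational.Properties as ℚ
open import Data.Sum.Base using (_⊎_)
open import Data.Vec.Base using (Vec; []; _∷_; lookup)
open import Relation.Binary.Construct.Closure.ReflexiveTransitive using (Star)
open import Relation.Binary.Construct.Closure.Transitive using (TransClosure)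
open import Relation.Binary.PropositionalEquality using (_≡_; refl; sym; trans; cong; subst; module ≡-Reasoning)
open import Relation.Nullary.Negation.Core using (¬_)

------------------------------------------------------------------------
-- Real numbers, as Cauchy sequences of rationals (with explicit moduli)

Cauchy : (ℕ → ℚ) → Set
Cauchy x = ∀ ε → 0ℚ ℚ.< ε →
  ∃[ N ] (∀ m n → N ℕ.≤ m → N ℕ.≤ n → ∣ x m ℚ.- x n ∣ ℚ.< ε)

record ℝ : Set where
  constructor mkℝ
  field
    seq    : ℕ → ℚ
    cauchy : Cauchy seq

open ℝ public

-- The order is that of the numbers represented, so _≤ᴿ_ is only a preorder
-- on representatives; x ≤ᴿ y × y ≤ᴿ x says that x and y are the same real.

infix 4 _<ᴿ_ _≤ᴿ_

_<ᴿ_ : ℝ → ℝ → Set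
x <ᴿ y = ∃[ ε ] (0ℚ ℚ.< ε × ∃[ N ] (∀ n → N ℕ.≤ n → seq x n ℚ.+ ε ℚ.≤ seq y n))

_≤ᴿ_ : ℝ → ℝ → Set
x ≤ᴿ y = ∀ ε → 0ℚ ℚ.< ε → ∃[ N ] (∀ n → N ℕ.≤ n → seq x n ℚ.≤ seq y n ℚ.+ ε)

fromℚ : ℚ → ℝ
fromℚ q = mkℝ (λ _ → q) λ ε 0<ε → 0 , λ _ _ _ _ →
  subst (ℚ._< ε) (sym (cong ∣_∣ (ℚ.+-inverseʳ q))) 0<ε

fromℤ : ℤ → ℝ
fromℤ i = fromℚ (i ℚ./ 1)

infixl 6 _-ᴿ_

_-ᴿ_ : ℝ → ℝ → ℝ
x -ᴿ y = mkℝ (λ n → seq x n ℚ.- seq y n) isCauchy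
  where
  open CommutativeSemigroupProperties
    (CommutativeMonoid.commutativeSemigroup ℚ.+-0-commutativeMonoid) using (interchange)

  regroup : ∀ a b c d → (a ℚ.- b) ℚ.- (c ℚ.- d) ≡ (a ℚ.- c) ℚ.- (b ℚ.- d)
  regroup a b c d = begin
    (a ℚ.- b) ℚ.- (c ℚ.- d)              ≡⟨ cong ((a ℚ.- b) ℚ.+_) (ℚ.neg-distrib-+ c (ℚ.- d)) ⟩
    (a ℚ.- b) ℚ.+ (ℚ.- c ℚ.- (ℚ.- d))    ≡⟨ interchange a (ℚ.- b) (ℚ.- c) (ℚ.- (ℚ.- d)) ⟩
    (a ℚ.- c) ℚ.+ (ℚ.- b ℚ.- (ℚ.- d))    ≡⟨ cong ((a ℚ.- c) ℚ.+_) (ℚ.neg-distrib-+ b (ℚ.- d)) ⟨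
    (a ℚ.- c) ℚ.- (b ℚ.- d)              ∎
    where open ≡-Reasoning

  halves : ∀ ε → ½ ℚ.* ε ℚ.+ ½ ℚ.* ε ≡ ε
  halves ε = trans (sym (ℚ.*-distribʳ-+ ε ½ ½)) (ℚ.*-identityˡ ε)

  isCauchy : Cauchy (λ n → seq x n ℚ.- seq y n)
  isCauchy ε 0<ε with
    cauchy x (½ ℚ.* ε) (ℚ.*-monoʳ-<-pos ½ 0<ε) | cauchy y (½ ℚ.* ε) (ℚ.*-monoʳ-<-pos ½ 0<ε)
  ... | N₁ , close₁ | N₂ , close₂ = N₁ ⊔ N₂ , λ m n N≤m N≤n → begin-strict
    ∣ (seq x m ℚ.- seq y m) ℚ.- (seq x n ℚ.- seq y n) ∣
      ≡⟨ cong ∣_∣ (regroup (seq x m) (seq y m) (seq x n) (seq y n)) ⟩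
    ∣ (seq x m ℚ.- seq x n) ℚ.- (seq y m ℚ.- seq y n) ∣
      ≤⟨ ℚ.∣p-q∣≤∣p∣+∣q∣ (seq x m ℚ.- seq x n) (seq y m ℚ.- seq y n) ⟩
    ∣ seq x m ℚ.- seq x n ∣ ℚ.+ ∣ seq y m ℚ.- seq y n ∣
      <⟨ ℚ.+-mono-< (close₁ m n (ℕ.m⊔n≤o⇒m≤o N₁ N₂ N≤m) (ℕ.m⊔n≤o⇒m≤o N₁ N₂ N≤n))
                    (close₂ m n (ℕ.m⊔n≤o⇒n≤o N₁ N₂ N≤m) (ℕ.m⊔n≤o⇒n≤o N₁ N₂ N≤n)) ⟩
    ½ ℚ.* ε ℚ.+ ½ ℚ.* ε
      ≡⟨ halves ε ⟩
    ε ∎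
    where open ℚ.≤-Reasoning

------------------------------------------------------------------------
-- Weighted graphs

data Cmp : Set where
  lt le : Cmp

⟦_⟧ᶜ : Cmp → ℝ → ℝ → Set
⟦ lt ⟧ᶜ = _<ᴿ_
⟦ le ⟧ᶜ = _≤ᴿ_

-- ∣ α ∣ < M is α ∈ {-(M-1), …, M-1}.  The bound is irrelevant, so that a
-- constraint label is determined by its comparison and its constant.

data Γ (M : ℕ) : Set where
  succ       : Γ M
  constraint : Cmp → (α : ℤ) → .(ℤ.∣ α ∣ ℕ.< M) → Γ M

-- Finite graphs, with vertex set taken to be Fin size.  The edge set is given
-- by its characteristic function.

record WeightedGraph (M : ℕ) : Set where
  field
    size : ℕ

  V : Set
  V = Fin size

  field
    edge : V → Γ M → V → Bool

  E : Γ M → V → V → Set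
  E γ u v = T (edge u γ v)

  field
    acyclic : ∀ u → ¬ TransClosure (E succ) u u

  infix 4 _≼_

  _≼_ : V → V → Set
  _≼_ = Star (E succ)

module _ {M : ℕ} (G : WeightedGraph M) where
  open WeightedGraph G

  record IsRealization (ts : V → ℝ) : Set where
    field
      constraints : ∀ u v ◁ α .(bound : ℤ.∣ α ∣ ℕ.< M) → E (constraint ◁ α bound) u v →
                    ⟦ ◁ ⟧ᶜ (ts v -ᴿ ts u) (fromℤ α)
      monotone    : ∀ u v → u ≼ v → ts u ≤ᴿ ts v

  Realizable : Set
  Realizable = Σ[ ts ∈ (V → ℝ) ] IsRealization ts

------------------------------------------------------------------------
-- Monadic second-order logic over the relations E γ

-- Formula M k l has k free vertex variables and l free set variables, as
-- de Bruijn indices; each sort of quantifier binds index 0 of its own sort.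

data Formula (M : ℕ) : ℕ → ℕ → Set where
  edge[_]     : ∀ {k l} → Γ M → Fin k → Fin k → Formula M k l
  _≐_         : ∀ {k l} → Fin k → Fin k → Formula M k l
  _∈̇_         : ∀ {k l} → Fin k → Fin l → Formula M k l
  ¬̇_          : ∀ {k l} → Formula M k l → Formula M k l
  _∧̇_ _∨̇_     : ∀ {k l} → Formula M k l → Formula M k l → Formula M k l
  ∃ᵛ_ ∀ᵛ_     : ∀ {k l} → Formula M (suc k) l → Formula M k l
  ∃ˢ_ ∀ˢ_     : ∀ {k l} → Formula M k (suc l) → Formula M k l

Sentence : ℕ → Set
Sentence M = Formula M 0 0

module _ {M : ℕ} (G : WeightedGraph M) where
  open WeightedGraph G

  Sat : ∀ {k l} → Vec V k → Vec (Subset size) l → Formula M k l → Set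
  Sat ρ σ (edge[ γ ] x y) = E γ (lookup ρ x) (lookup ρ y)
  Sat ρ σ (x ≐ y)         = lookup ρ x ≡ lookup ρ y
  Sat ρ σ (x ∈̇ X)         = lookup ρ x ∈ lookup σ X
  Sat ρ σ (¬̇ φ)           = ¬ Sat ρ σ φ
  Sat ρ σ (φ ∧̇ ψ)         = Sat ρ σ φ × Sat ρ σ ψ
  Sat ρ σ (φ ∨̇ ψ)         = Sat ρ σ φ ⊎ Sat ρ σ ψ
  Sat ρ σ (∃ᵛ φ)          = ∃[ v ] Sat (v ∷ ρ) σ φ
  Sat ρ σ (∀ᵛ φ)          = ∀ v → Sat (v ∷ ρ) σ φ
  Sat ρ σ (∃ˢ φ)          = ∃[ S ] Sat ρ (S ∷ σ) φ
  Sat ρ σ (∀ˢ φ)          = ∀ S → Sat ρ (S ∷ σ) φ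

infix 4 _⊨_

_⊨_ : ∀ {M} → WeightedGraph M → Sentence M → Set
G ⊨ φ = Sat G [] [] φ

{-# OPTIONS --safe #-}
-- The graph G n m consists of a chain a₀, …, aₙ with aᵢ₊₁ − aᵢ ≤ 1, a chain b₀, …, bₘ with
-- bⱼ₊₁ − bⱼ ≥ 1, and the two constraints a₀ ≤ b₀ and bₘ ≤ aₙ; it is realizable only if m ≤ n, and
-- aᵢ = bᵢ = i realizes G n n.  By induction on φ, the chains a (of all lengths, with an assignment
-- of the variables) admit a finite colouring such that equally coloured chains can be
-- exchanged inside G n m without affecting φ.  By the pigeonhole principle two chains of different
-- lengths n < n′ have the same colour, so φ cannot separate G n n′ from G n′ n′.
module Submission where

open import Defs
open import Data.Bool.Base using (Bool; true; false; T; _∧_)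
open import Data.Bool.Properties using (T-∧; T-≡)
open import Data.Empty using (⊥)
open import Data.Fin.Base using (Fin; zero; suc; toℕ; fromℕ<; splitAt; join; combine; finToFun; funToFin)
open import Data.Fin.Properties as Fin using (2↔Bool; any?; pigeonhole)
open import Data.Fin.Subset using (Subset)
open import Data.Fin.Subset.Properties using (anySubset?)
open import Data.Integer.Base as ℤ using (ℤ; 0ℤ; 1ℤ; -1ℤ)
import Data.Integer.Properties as ℤ
open import Data.Maybe.Base using (Maybe; just; nothing)
open import Data.Nat.Base as ℕ using (ℕ; zero; suc; _≡ᵇ_; s≤s; z≤n)
import Data.Nat.Properties as ℕ
open import Data.Product.Base using (Σ-syntax; ∃; ∃-syntax; _×_; _,_)
open import Data.Rational.Base as ℚ using (ℚ; 0ℚ; 1ℚ; ½)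
import Data.Rational.Properties as ℚ
open import Data.Rational.Solver using (module +-*-Solver)
open import Data.Sum.Base as Sum using (_⊎_; inj₁; inj₂; [_,_]′)
open import Data.Vec.Base as Vec using (Vec; []; _∷_; lookup; zipWith; _++_)
open import Data.Vec.Properties using (lookup-zipWith; lookup-splitAt; lookup⇒[]=; []=⇒lookup)
open import Function.Base using (_∘_; _on_)
open import Function.Bundles using (_⇔_; Equivalence; Inverse)
open import Level using (0ℓ)
open import Relation.Binary.Construct.Closure.ReflexiveTransitive using (_◅_) renaming (ε to stop)
open import Relation.Binary.Construct.Closure.Transitive using ([_]; _∷_)
open import Relation.Binary.Core using (Rel)
open import Relation.Binary.PropositionalEquality using (_≡_; refl; sym; trans; cong; cong₂; subst; subst₂; module ≡-Reasoning)
open import Relation.Nullary.Decidable using (Dec; does; yes; no; dec-true; toWitness; toWitnessFalse)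
open import Relation.Nullary.Negation.Core using (¬_; contradiction)
open import Relation.Unary using (Pred; Decidable)

-- Finite colourings

-- `R` need not be an equivalence: it only has to contain the kernel of a map into a finite set.
-- This allows one-directional relations such as an implication.
Coloured : {X : Set} → Rel X 0ℓ → Set
Coloured {X} R = ∃[ N ] Σ[ c ∈ (X → Fin N) ] (∀ {x y} → c x ≡ c y → R x y)

module _ {X : Set} where

  weaken : {R S : Rel X 0ℓ} → (∀ x y → R x y → S x y) → Coloured R → Coloured S
  weaken R⊆S (N , c , sound) = N , c , R⊆S _ _ ∘ sound

  converse : {R : Rel X 0ℓ} → Coloured R → Coloured (λ x y → R y x)
  converse (N , c , sound) = N , c , sound ∘ sym

  _⊗_ : {R S : Rel X 0ℓ} → Coloured R → Coloured S → Coloured (λ x y → R x y × S x y)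
  (M , c , sound₁) ⊗ (N , d , sound₂) = M ℕ.* N , (λ x → combine (c x) (d x)) , λ eq →
    let c≡ , d≡ = Fin.combine-injective _ _ _ _ eq in sound₁ c≡ , sound₂ d≡

  -- The `N` bits are packed into one number below `2 ^ N`; unpacking it recovers them pointwise, so
  -- no equality of functions is needed.
  colourBits : ∀ {N} (f : Fin N → X → Bool) → Coloured (λ x y → ∀ t → f t x ≡ f t y)
  colourBits {N} f = 2 ℕ.^ N , (λ x → funToFin (λ t → Inverse.from 2↔Bool (f t x))) , λ {x} {y} eq t →
    let open ≡-Reasoning
        g : X → Fin N → Fin 2
        g = λ x t → Inverse.from 2↔Bool (f t x)
    in begin
      f t x                                                ≡⟨ Inverse.strictlyInverseˡ 2↔Bool (f t x) ⟨
      Inverse.to 2↔Bool (g x t)                            ≡⟨ cong (Inverse.to 2↔Bool) (Fin.finToFun-funToFin (g x) t) ⟨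
      Inverse.to 2↔Bool (finToFun (funToFin (g x)) t)      ≡⟨ cong (λ k → Inverse.to 2↔Bool (finToFun k t)) eq ⟩
      Inverse.to 2↔Bool (finToFun (funToFin (g y)) t)      ≡⟨ cong (Inverse.to 2↔Bool) (Fin.finToFun-funToFin (g y) t) ⟩
      Inverse.to 2↔Bool (g y t)                            ≡⟨ Inverse.strictlyInverseˡ 2↔Bool (f t y) ⟩
      f t y                                                ∎

  colourBit : (f : X → Bool) → Coloured (_≡_ on f)
  colourBit f = weaken (λ _ _ same → same zero) (colourBits {1} (λ _ → f))

witness : {A : Set} (d : Dec A) → does d ≡ true → A
witness (yes a) refl = a

-- Makes the set of colours that occur in a family a computable vector of Booleans.
Searchable : Set → Set₁
Searchable I = {P : Pred I 0ℓ} → Decidable P → Dec (∃ P)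

-- A point is coloured by the set of colours of its family.

colourFamily : {X Y : Set} {R : Rel Y 0ℓ} {I : X → Set} → (∀ x → Searchable (I x)) → (g : ∀ x → I x → Y) →
               Coloured R → Coloured (λ x y → ∀ i → ∃[ j ] R (g x i) (g y j))
colourFamily {X} {R = R} {I} search g (N , c , sound) = weaken match (colourBits occurs)
  where
  occurs? : ∀ t x → Dec (∃[ i ] c (g x i) ≡ t)
  occurs? t x = search x (λ i → c (g x i) Fin.≟ t)

  occurs : Fin N → X → Bool
  occurs t x = does (occurs? t x)

  match : ∀ x y → (∀ t → occurs t x ≡ occurs t y) → ∀ i → ∃[ j ] R (g x i) (g y j)
  match x y same i =
    let t     = c (g x i)
        found = trans (sym (same t)) (dec-true (occurs? t x) (i , refl))
        j , e = witness (occurs? t y) found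
    in j , sound (sym e)

-- The graphs G n m

hasWeight : ℤ → Γ 2 → Bool
hasWeight α succ                = false
hasWeight α (constraint lt β _) = false
hasWeight α (constraint le β _) = does (α ℤ.≟ β)

-- An edge of weight α from u to v bounds v - u from above by α. Hence bⱼ₊₁ - bⱼ ≥ 1 becomes an edge
-- of weight -1 from bⱼ₊₁ back to bⱼ, and the edges of weight 0 run from aₙ to bₘ and from b₀ to a₀.
link : ∀ n m → Fin (suc n) ⊎ Fin (suc m) → Γ 2 → Fin (suc n) ⊎ Fin (suc m) → Bool
link n m (inj₁ i) γ (inj₁ j) = hasWeight 1ℤ γ ∧ (toℕ j ≡ᵇ suc (toℕ i))
link n m (inj₁ i) γ (inj₂ j) = hasWeight 0ℤ γ ∧ ((toℕ i ≡ᵇ n) ∧ (toℕ j ≡ᵇ m))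
link n m (inj₂ i) γ (inj₁ j) = hasWeight 0ℤ γ ∧ ((toℕ i ≡ᵇ 0) ∧ (toℕ j ≡ᵇ 0))
link n m (inj₂ i) γ (inj₂ j) = hasWeight -1ℤ γ ∧ (toℕ i ≡ᵇ suc (toℕ j))

-- Makes acyclicity vacuous and reduces `≼` to equality.
link-succ : ∀ n m s t → ¬ T (link n m s succ t)
link-succ n m (inj₁ _) (inj₁ _) ()
link-succ n m (inj₁ _) (inj₂ _) ()
link-succ n m (inj₂ _) (inj₁ _) ()
link-succ n m (inj₂ _) (inj₂ _) ()

G : ℕ → ℕ → WeightedGraph 2
G n m = record
  { size    = suc n ℕ.+ suc m
  ; edge    = λ u γ v → link n m (splitAt (suc n) u) γ (splitAt (suc n) v)
  ; acyclic = λ { u [ e ]             → link-succ n m (splitAt (suc n) u) (splitAt (suc n) u) e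
                ; u (_∷_ {y = v} e _) → link-succ n m (splitAt (suc n) u) (splitAt (suc n) v) e }
  }

-- Exchanging equally coloured chains

-- A chain with values for all variables; which variables really lie in the chain is decided by the
-- context, which overrides the values of the others.

record Chain (k l : ℕ) : Set where
  constructor chain
  field
    len   : ℕ
    verts : Vec (Fin (suc len)) k
    sets  : Vec (Subset (suc len)) l

open Chain

-- The chain b with the traces of the set variables on it; `nothing` marks a vertex variable whose
-- value lies in the chain a.
record Context (k l : ℕ) : Set where
  constructor context
  field
    len   : ℕ
    verts : Vec (Maybe (Fin (suc len))) k
    sets  : Vec (Subset (suc len)) l

override : ∀ {A B : Set} → A → Maybe B → A ⊎ B
override i nothing  = inj₁ i
override i (just j) = inj₂ j

plug : ∀ {a b} → Fin a → Maybe (Fin b) → Fin (a ℕ.+ b)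
plug i o = join _ _ (override i o)

Holds : ∀ {k l} → Formula 2 k l → Chain k l → Context k l → Set
Holds φ (chain n ρ σ) (context m r τ) = Sat (G n m) (zipWith plug ρ r) (zipWith _++_ σ τ) φ

-- Quantifying over all contexts makes one colouring serve every m and every distribution of the
-- variables over the two chains.
Transfers : ∀ {k l} → Formula 2 k l → Rel (Chain k l) 0ℓ
Transfers φ x y = ∀ C → Holds φ x C → Holds φ y C

splitAt-plug : ∀ {k} a {b} (ρ : Vec (Fin a) k) (r : Vec (Maybe (Fin b)) k) i →
               splitAt a (lookup (zipWith plug ρ r) i) ≡ override (lookup ρ i) (lookup r i)
splitAt-plug a ρ r i = trans (cong (splitAt a) (lookup-zipWith plug i ρ r))
                             (Fin.splitAt-join a _ (override (lookup ρ i) (lookup r i)))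

addVertex : ∀ {k l} (x : Chain k l) → Fin (suc (len x)) → Chain (suc k) l
addVertex (chain n ρ σ) v = chain n (v ∷ ρ) σ

addSet : ∀ {k l} (x : Chain k l) → Subset (suc (len x)) → Chain k (suc l)
addSet (chain n ρ σ) S = chain n ρ (S ∷ σ)

-- An edge sees the chain a in only three ways: it leaves from the last vertex towards b, enters the
-- first vertex from b, or joins two consecutive vertices. One bit records each.
link-override : ∀ {n n′ m} γ (i j : Fin (suc n)) (i′ j′ : Fin (suc n′)) →
                (toℕ i ≡ᵇ n) ≡ (toℕ i′ ≡ᵇ n′) → (toℕ j ≡ᵇ 0) ≡ (toℕ j′ ≡ᵇ 0) →
                (toℕ j ≡ᵇ suc (toℕ i)) ≡ (toℕ j′ ≡ᵇ suc (toℕ i′)) → (o p : Maybe (Fin (suc m))) →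
                link n m (override i o) γ (override j p) ≡ link n′ m (override i′ o) γ (override j′ p)
link-override γ i j i′ j′ last first next nothing nothing = cong (hasWeight 1ℤ γ ∧_) next
link-override {m = m} γ i j i′ j′ last first next nothing (just w) =
  cong (λ b → hasWeight 0ℤ γ ∧ (b ∧ (toℕ w ≡ᵇ m))) last
link-override γ i j i′ j′ last first next (just w) nothing =
  cong (λ b → hasWeight 0ℤ γ ∧ ((toℕ w ≡ᵇ 0) ∧ b)) first
link-override γ i j i′ j′ last first next (just _) (just _) = refl

override-≡ : ∀ {A A′ B : Set} {i j : A} {i′ j′ : A′} → (i ≡ j → i′ ≡ j′) → (o p : Maybe B) →
             override i o ≡ override j p → override i′ o ≡ override j′ p
override-≡ f nothing  nothing  refl = cong inj₁ (f refl)
override-≡ f (just _) (just _) refl = refl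

module _ {k l : ℕ} where

  rank : (X : Chain k l) → Fin k → ℕ
  rank X x = toℕ (lookup (verts X) x)

  same? : (x y : Fin k) (X : Chain k l) → Dec (lookup (verts X) x ≡ lookup (verts X) y)
  same? x y X = lookup (verts X) x Fin.≟ lookup (verts X) y

  member : Fin k → Fin l → Chain k l → Bool
  member x Z X = lookup (lookup (sets X) Z) (lookup (verts X) x)

  transfer-edge : ∀ γ x y (X Y : Chain k l) → (rank X x ≡ᵇ len X) ≡ (rank Y x ≡ᵇ len Y) →
                  (rank X y ≡ᵇ 0) ≡ (rank Y y ≡ᵇ 0) →
                  (rank X y ≡ᵇ suc (rank X x)) ≡ (rank Y y ≡ᵇ suc (rank Y x)) →
                  Transfers (edge[ γ ] x y) X Y
  transfer-edge γ x y (chain n ρ σ) (chain n′ ρ′ σ′) last first next (context m r τ) = subst T (begin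
    link n m (splitAt (suc n) (lookup (zipWith plug ρ r) x)) γ (splitAt (suc n) (lookup (zipWith plug ρ r) y))
      ≡⟨ cong₂ (λ s t → link n m s γ t) (splitAt-plug _ ρ r x) (splitAt-plug _ ρ r y) ⟩
    link n m (override (lookup ρ x) (lookup r x)) γ (override (lookup ρ y) (lookup r y))
      ≡⟨ link-override γ _ _ _ _ last first next (lookup r x) (lookup r y) ⟩
    link n′ m (override (lookup ρ′ x) (lookup r x)) γ (override (lookup ρ′ y) (lookup r y))
      ≡⟨ cong₂ (λ s t → link n′ m s γ t) (splitAt-plug _ ρ′ r x) (splitAt-plug _ ρ′ r y) ⟨
    link n′ m (splitAt (suc n′) (lookup (zipWith plug ρ′ r) x)) γ (splitAt (suc n′) (lookup (zipWith plug ρ′ r) y)) ∎)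
    where open ≡-Reasoning

  transfer-≐ : ∀ x y (X Y : Chain k l) → does (same? x y X) ≡ does (same? x y Y) → Transfers (x ≐ y) X Y
  transfer-≐ x y X@(chain n ρ σ) Y@(chain n′ ρ′ σ′) same (context m r τ) h = begin
    lookup (zipWith plug ρ′ r) x        ≡⟨ lookup-zipWith plug x ρ′ r ⟩
    plug (lookup ρ′ x) (lookup r x)     ≡⟨ cong (join _ _) (override-≡ moved (lookup r x) (lookup r y) split) ⟩
    plug (lookup ρ′ y) (lookup r y)     ≡⟨ lookup-zipWith plug y ρ′ r ⟨
    lookup (zipWith plug ρ′ r) y        ∎
    where
    open ≡-Reasoning
    moved : lookup ρ x ≡ lookup ρ y → lookup ρ′ x ≡ lookup ρ′ y
    moved eq = witness (same? x y Y) (trans (sym same) (dec-true (same? x y X) eq))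
    split : override (lookup ρ x) (lookup r x) ≡ override (lookup ρ y) (lookup r y)
    split = trans (sym (splitAt-plug _ ρ r x)) (trans (cong (splitAt (suc n)) h) (splitAt-plug _ ρ r y))

  transfer-∈ : ∀ x Z (X Y : Chain k l) → member x Z X ≡ member x Z Y → Transfers (x ∈̇ Z) X Y
  transfer-∈ x Z (chain n ρ σ) (chain n′ ρ′ σ′) same (context m r τ) h =
    lookup⇒[]= _ _ (trans (sym (trans (value ρ σ) (trans (moved (lookup r x)) (sym (value ρ′ σ′))))) ([]=⇒lookup h))
    where
    value : ∀ {n} (ρ : Vec (Fin (suc n)) k) (σ : Vec (Subset (suc n)) l) →
            lookup (lookup (zipWith _++_ σ τ) Z) (lookup (zipWith plug ρ r) x) ≡
            [ lookup (lookup σ Z) , lookup (lookup τ Z) ]′ (override (lookup ρ x) (lookup r x))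
    value {n} ρ σ = trans (cong (λ S → lookup S (lookup (zipWith plug ρ r) x)) (lookup-zipWith _++_ Z σ τ))
               (trans (lookup-splitAt (suc n) (lookup σ Z) (lookup τ Z) (lookup (zipWith plug ρ r) x))
                      (cong [ lookup (lookup σ Z) , lookup (lookup τ Z) ]′ (splitAt-plug _ ρ r x)))
    moved : ∀ o → [ lookup (lookup σ Z) , lookup (lookup τ Z) ]′ (override (lookup ρ x) o) ≡
                  [ lookup (lookup σ′ Z) , lookup (lookup τ Z) ]′ (override (lookup ρ′ x) o)
    moved nothing  = same
    moved (just _) = refl

  -- A vertex outside the chain is represented in the chain by an arbitrary value, here zero.

  transfer-∃ᵛ : ∀ φ (X Y : Chain k l) → (∀ i → ∃[ j ] Transfers φ (addVertex X i) (addVertex Y j)) →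
                Transfers (∃ᵛ φ) X Y
  transfer-∃ᵛ φ X Y f (context m r τ) (v , h)
    with splitAt (suc (len X)) v | Fin.join-splitAt (suc (len X)) (suc m) v
  ... | inj₁ i | refl = let j , t = f i    in plug j nothing  , t (context m (nothing ∷ r) τ) h
  ... | inj₂ w | refl = let j , t = f zero in plug j (just w) , t (context m (just w ∷ r) τ) h

  -- The vertex to be answered now comes from `Y`, so the matching runs from `Y` back to `X`.
  transfer-∀ᵛ : ∀ φ (X Y : Chain k l) → (∀ j → ∃[ i ] Transfers φ (addVertex X i) (addVertex Y j)) →
                Transfers (∀ᵛ φ) X Y
  transfer-∀ᵛ φ X Y f (context m r τ) h v
    with splitAt (suc (len Y)) v | Fin.join-splitAt (suc (len Y)) (suc m) v
  ... | inj₁ j | refl = let i , t = f j    in t (context m (nothing ∷ r) τ) (h (plug i nothing))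
  ... | inj₂ w | refl = let i , t = f zero in t (context m (just w ∷ r) τ) (h (plug i (just w)))

  -- A vertex set splits into its traces on the two chains: the trace on a is exchanged through `f`,
  -- the trace on b moves into the context.
  transfer-∃ˢ : ∀ φ (X Y : Chain k l) → (∀ S → ∃[ S′ ] Transfers φ (addSet X S) (addSet Y S′)) →
                Transfers (∃ˢ φ) X Y
  transfer-∃ˢ φ X Y f (context m r τ) (S , h) with Vec.splitAt (suc (len X)) S
  ... | S₁ , S₂ , refl = let S′ , t = f S₁ in S′ ++ S₂ , t (context m r (S₂ ∷ τ)) h

  transfer-∀ˢ : ∀ φ (X Y : Chain k l) → (∀ S′ → ∃[ S ] Transfers φ (addSet X S) (addSet Y S′)) →
                Transfers (∀ˢ φ) X Y
  transfer-∀ˢ φ X Y f (context m r τ) h S with Vec.splitAt (suc (len Y)) S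
  ... | S₁ , S₂ , refl = let S′ , t = f S₁ in t (context m r (S₂ ∷ τ)) (h (S′ ++ S₂))

-- Binary connectives take products of colourings, and negation reverses the direction of transfer.
-- A quantifier colours a chain by the set of colours of its one-variable extensions.
colourFormula : ∀ {k l} (φ : Formula 2 k l) → Coloured (Transfers φ)
colourFormula (edge[ γ ] x y) =
  weaken (λ X Y (last , first , next) → transfer-edge γ x y X Y last first next)
    (colourBit (λ X → rank X x ≡ᵇ len X) ⊗
    (colourBit (λ X → rank X y ≡ᵇ 0) ⊗
     colourBit (λ X → rank X y ≡ᵇ suc (rank X x))))
colourFormula (x ≐ y) = weaken (transfer-≐ x y) (colourBit (does ∘ same? x y))
colourFormula (x ∈̇ Z) = weaken (transfer-∈ x Z) (colourBit (member x Z))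
colourFormula (¬̇ φ)   = weaken (λ _ _ back C ¬h h → ¬h (back C h)) (converse (colourFormula φ))
colourFormula (φ ∧̇ ψ) =
  weaken (λ _ _ (f , g) C (h , k) → f C h , g C k) (colourFormula φ ⊗ colourFormula ψ)
colourFormula (φ ∨̇ ψ) =
  weaken (λ _ _ (f , g) C → Sum.map (f C) (g C)) (colourFormula φ ⊗ colourFormula ψ)
colourFormula (∃ᵛ φ) =
  weaken (transfer-∃ᵛ φ) (colourFamily (λ _ → any?) addVertex (colourFormula φ))
-- The outer `converse` lets the challenge range over the second chain; the inner one restores the
-- direction of the transfer.
colourFormula (∀ᵛ φ) =
  weaken (transfer-∀ᵛ φ) (converse (colourFamily (λ _ → any?) addVertex (converse (colourFormula φ))))
colourFormula (∃ˢ φ) =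
  weaken (transfer-∃ˢ φ) (colourFamily (λ _ → anySubset?) addSet (colourFormula φ))
colourFormula (∀ˢ φ) =
  weaken (transfer-∀ˢ φ) (converse (colourFamily (λ _ → anySubset?) addSet (converse (colourFormula φ))))

-- Among the `N + 1` lengths 0, ..., N two share a colour. The transfer is taken from the longer
-- chain to the shorter one, towards the unrealizable graph.
indistinguishable : (φ : Sentence 2) → ∃[ n ] ∃[ n′ ] (n ℕ.< n′ × (∀ m → G n′ m ⊨ φ → G n m ⊨ φ))
indistinguishable φ =
  let N , c , sound = colourFormula φ
      i , j , i<j , eq = pigeonhole (ℕ.n<1+n N) (λ i → c (chain (toℕ i) [] []))
  in toℕ i , toℕ j , i<j , λ m → sound (sym eq) (context m [] [])

-- Realizability of G n m

-- A record, so that x, y and c can be inferred.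

record Gap (x y : ℝ) (c : ℚ) : Set where
  constructor gap
  field
    bound : (x -ᴿ y) ≤ᴿ fromℚ c

gap-trans : ∀ {x y z c d} → Gap x y c → Gap y z d → Gap x z (c ℚ.+ d)
gap-trans {x} {y} {z} {c} {d} (gap p) (gap q) = gap λ ε 0<ε →
  let N₁ , p′ = p (½ ℚ.* ε) (ℚ.*-monoʳ-<-pos ½ 0<ε)
      N₂ , q′ = q (½ ℚ.* ε) (ℚ.*-monoʳ-<-pos ½ 0<ε)
  in N₁ ℕ.⊔ N₂ , λ n N≤n → begin
  seq x n ℚ.- seq z n
    ≡⟨ solve 3 (λ x y z → x :- z := (x :- y) :+ (y :- z)) refl (seq x n) (seq y n) (seq z n) ⟩
  (seq x n ℚ.- seq y n) ℚ.+ (seq y n ℚ.- seq z n)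
    ≤⟨ ℚ.+-mono-≤ (p′ n (ℕ.m⊔n≤o⇒m≤o N₁ N₂ N≤n)) (q′ n (ℕ.m⊔n≤o⇒n≤o N₁ N₂ N≤n)) ⟩
  (c ℚ.+ ½ ℚ.* ε) ℚ.+ (d ℚ.+ ½ ℚ.* ε)
    ≡⟨ solve 3 (λ c d ε → (c :+ con ½ :* ε) :+ (d :+ con ½ :* ε) := (c :+ d) :+ ε) refl c d ε ⟩
  (c ℚ.+ d) ℚ.+ ε ∎
  where
  open ℚ.≤-Reasoning
  open +-*-Solver

gap-mono : ∀ {x y c d} → c ℚ.≤ d → Gap x y c → Gap x y d
gap-mono c≤d (gap p) = gap λ ε 0<ε →
  let N , p′ = p ε 0<ε in N , λ n N≤n → ℚ.≤-trans (p′ n N≤n) (ℚ.+-monoˡ-≤ ε c≤d)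

gap-irrefl : ∀ {x} → ¬ Gap x x (ℚ.- 1ℚ)
-- With tolerance ½ the bound at index `N` reads 0 ≤ -1 + ½.
gap-irrefl {x} (gap p) with p ½ (toWitness {a? = 0ℚ ℚ.<? ½} _)
... | N , p′ = toWitnessFalse {a? = 0ℚ ℚ.≤? (ℚ.- 1ℚ ℚ.+ ½)} _
  (subst (ℚ._≤ _) (ℚ.+-inverseʳ (seq x N)) (p′ N ℕ.≤-refl))

module _ {n m : ℕ} (n<m : n ℕ.< m) (ts : Fin (suc n ℕ.+ suc m) → ℝ) (real : IsRealization (G n m) ts) where
  open IsRealization real

  private
    time : Fin (suc n) ⊎ Fin (suc m) → ℝ
    time s = ts (join (suc n) (suc m) s)

    link-gap : ∀ s t α .(bound : ℤ.∣ α ∣ ℕ.< 2) → T (link n m s (constraint le α bound) t) →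
               Gap (time t) (time s) (α ℚ./ 1)
    link-gap s t α bound e = gap (constraints _ _ le α bound
      (subst₂ (λ s t → T (link n m s (constraint le α bound) t))
              (sym (Fin.splitAt-join (suc n) (suc m) s)) (sym (Fin.splitAt-join (suc n) (suc m) t)) e))

    a : ∀ {i} → i ℕ.≤ n → ℝ
    a i≤n = time (inj₁ (fromℕ< (s≤s i≤n)))

    b : ∀ {j} → j ℕ.≤ m → ℝ
    b j≤m = time (inj₂ (fromℕ< (s≤s j≤m)))

    ends≡ᵇ : ∀ k → T (toℕ (fromℕ< (ℕ.n<1+n k)) ≡ᵇ k)
    ends≡ᵇ k = ℕ.≡⇒≡ᵇ _ k (Fin.toℕ-fromℕ< (ℕ.n<1+n k))

    step≡ᵇ : ∀ {k i} (p : suc i ℕ.< k) (q : i ℕ.< k) → T (toℕ (fromℕ< p) ≡ᵇ suc (toℕ (fromℕ< q)))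
    step≡ᵇ p q = ℕ.≡⇒≡ᵇ _ _ (trans (Fin.toℕ-fromℕ< p) (cong suc (sym (Fin.toℕ-fromℕ< q))))

    a-step : ∀ {i} (p : suc i ℕ.≤ n) (q : i ℕ.≤ n) → Gap (a p) (a q) 1ℚ
    a-step p q = link-gap (inj₁ _) (inj₁ _) 1ℤ (s≤s (s≤s z≤n)) (step≡ᵇ (s≤s p) (s≤s q))

    b-step : ∀ {j} (p : suc j ℕ.≤ m) (q : j ℕ.≤ m) → Gap (b q) (b p) (ℚ.- 1ℚ)
    b-step p q = link-gap (inj₂ _) (inj₂ _) -1ℤ (s≤s (s≤s z≤n)) (step≡ᵇ (s≤s p) (s≤s q))

    bottom : Gap (a z≤n) (b z≤n) 0ℚ
    bottom = link-gap (inj₂ _) (inj₁ _) 0ℤ (s≤s z≤n) _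

    top : Gap (b ℕ.≤-refl) (a ℕ.≤-refl) 0ℚ
    top = link-gap (inj₁ _) (inj₂ _) 0ℤ (s≤s z≤n)
      (Equivalence.from (T-∧ {x = toℕ (fromℕ< (ℕ.n<1+n n)) ≡ᵇ n})
        (ends≡ᵇ n , ends≡ᵇ m))

    -- Induction along both chains: aᵢ₊₁ ≤ aᵢ + 1 ≤ bᵢ + 1 ≤ bᵢ₊₁. The accumulated bound 1 + 0 - 1
    -- computes to `0ℚ`.
    a≤b : ∀ i (p : i ℕ.≤ n) (q : i ℕ.≤ m) → Gap (a p) (b q) 0ℚ
    a≤b zero    z≤n z≤n = bottom
    a≤b (suc i) p   q   =
      gap-trans (gap-trans (a-step p p′) (a≤b i p′ q′)) (b-step q q′)
      where
      p′ : i ℕ.≤ n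
      p′ = ℕ.<⇒≤ p
      q′ : i ℕ.≤ m
      q′ = ℕ.<⇒≤ q

    b-climb : ∀ {i j} (p : i ℕ.≤ m) (q : j ℕ.≤ m) → i ℕ.<′ j → Gap (b p) (b q) (ℚ.- 1ℚ)
    b-climb p q ℕ.<′-base         = b-step q p
    b-climb p q (ℕ.<′-step {j} i<j) =
      -- A total climb of 1 is enough for the contradiction, so -2 is relaxed to -1.
      gap-mono (toWitness {a? = (ℚ.- 1ℚ ℚ.+ ℚ.- 1ℚ) ℚ.≤? ℚ.- 1ℚ} _)
        (gap-trans (b-climb p q′ i<j) (b-step q q′))
      where
      q′ : j ℕ.≤ m
      q′ = ℕ.<⇒≤ q

  no-realization : ⊥
  no-realization =
    -- The cycle aₙ ≤ bₙ ≤ bₘ - 1 ≤ aₙ - 1.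
    gap-irrefl (gap-trans (gap-trans (a≤b n ℕ.≤-refl n≤m) (b-climb n≤m ℕ.≤-refl (ℕ.<⇒<′ n<m))) top)
    where
    n≤m : n ℕ.≤ m
    n≤m = ℕ.<⇒≤ n<m

¬realizable : ∀ {n m} → n ℕ.< m → ¬ Realizable (G n m)
¬realizable n<m (ts , real) = no-realization n<m ts real

-- Timestamps realizing `G n n`

fromℚ-mono : ∀ {p q} → p ℚ.≤ q → fromℚ p ≤ᴿ fromℚ q
fromℚ-mono {p} {q} p≤q ε 0<ε = 0 , λ _ _ →
  subst (ℚ._≤ q ℚ.+ ε) (ℚ.+-identityʳ p) (ℚ.+-mono-≤ p≤q (ℚ.<⇒≤ 0<ε))

-- The embedding of ℕ into ℚ, given by recursion so that differences of consecutive values are ring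
-- identities.
height : ℕ → ℚ
height zero    = 0ℚ
height (suc i) = 1ℚ ℚ.+ height i

height-suc-i : ∀ i → height (suc i) ℚ.- height i ≡ 1ℚ
height-suc-i i = solve 1 (λ h → (con 1ℚ :+ h) :- h := con 1ℚ) refl (height i)
  where open +-*-Solver

height-i-suc : ∀ i → height i ℚ.- height (suc i) ≡ ℚ.- 1ℚ
height-i-suc i = solve 1 (λ h → h :- (con 1ℚ :+ h) := con (ℚ.- 1ℚ)) refl (height i)
  where open +-*-Solver

module _ (n : ℕ) where

  private
    level : Fin (suc n) ⊎ Fin (suc n) → ℕ
    level = [ toℕ , toℕ ]′

    difference : Fin (suc n) ⊎ Fin (suc n) → Fin (suc n) ⊎ Fin (suc n) → ℚ
    difference s t = height (level t) ℚ.- height (level s)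

    hasWeight⇒ : ∀ α ◁ β .(bound : ℤ.∣ β ∣ ℕ.< 2) → T (hasWeight α (constraint ◁ β bound)) → ◁ ≡ le × α ≡ β
    hasWeight⇒ α le β bound w = refl , witness (α ℤ.≟ β) (Equivalence.to T-≡ w)

    weigh : ∀ α {p} ◁ β .(bound : ℤ.∣ β ∣ ℕ.< 2) → T (hasWeight α (constraint ◁ β bound)) →
            p ≡ α ℚ./ 1 → ◁ ≡ le × p ≡ β ℚ./ 1
    weigh α ◁ β bound w eq with refl , refl ← hasWeight⇒ α ◁ β bound w = refl , eq

    level-≡ : ∀ {i j} → i ≡ j → height i ℚ.- height j ≡ 0ℚ
    level-≡ {i} refl = ℚ.+-inverseʳ (height i)

    -- Under aᵢ = bᵢ = i every constraint is attained with equality, so checking it amounts to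
    -- computing a difference of heights.
    link-tight : ∀ s t ◁ β .(bound : ℤ.∣ β ∣ ℕ.< 2) → T (link n n s (constraint ◁ β bound) t) →
                 ◁ ≡ le × difference s t ≡ β ℚ./ 1
    link-tight (inj₁ i) (inj₁ j) ◁ β bound e with w , p ← Equivalence.to T-∧ e =
      weigh 1ℤ ◁ β bound w (trans (cong (λ k → height k ℚ.- height (toℕ i)) (ℕ.≡ᵇ⇒≡ (toℕ j) _ p)) (height-suc-i (toℕ i)))
    link-tight (inj₁ i) (inj₂ j) ◁ β bound e
      with w , p ← Equivalence.to T-∧ e
      with p₁ , p₂ ← Equivalence.to (T-∧ {x = toℕ i ≡ᵇ n}) p =
      weigh 0ℤ ◁ β bound w (level-≡ (trans (ℕ.≡ᵇ⇒≡ (toℕ j) n p₂) (sym (ℕ.≡ᵇ⇒≡ (toℕ i) n p₁))))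
    link-tight (inj₂ i) (inj₁ j) ◁ β bound e
      with w , p ← Equivalence.to T-∧ e
      with p₁ , p₂ ← Equivalence.to (T-∧ {x = toℕ i ≡ᵇ 0}) p =
      weigh 0ℤ ◁ β bound w (level-≡ (trans (ℕ.≡ᵇ⇒≡ (toℕ j) 0 p₂) (sym (ℕ.≡ᵇ⇒≡ (toℕ i) 0 p₁))))
    link-tight (inj₂ i) (inj₂ j) ◁ β bound e with w , p ← Equivalence.to T-∧ e =
      weigh -1ℤ ◁ β bound w (trans (cong (λ k → height (toℕ j) ℚ.- height k) (ℕ.≡ᵇ⇒≡ (toℕ i) _ p)) (height-i-suc (toℕ j)))

  realizable : Realizable (G n n)
  realizable = ts , record
    { constraints = meets
    ; monotone    = λ { u .u stop → fromℚ-mono ℚ.≤-refl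
                      ; u v (_◅_ {j = w} e _) → contradiction e (link-succ n n (splitAt (suc n) u) (splitAt (suc n) w)) }
    }
    where
    ts : Fin (suc n ℕ.+ suc n) → ℝ
    ts v = fromℚ (height (level (splitAt (suc n) v)))

    meets : ∀ u v ◁ α .(bound : ℤ.∣ α ∣ ℕ.< 2) → T (link n n (splitAt (suc n) u) (constraint ◁ α bound) (splitAt (suc n) v)) →
            ⟦ ◁ ⟧ᶜ (ts v -ᴿ ts u) (fromℤ α)
    meets u v ◁ α bound e with refl , eq ← link-tight (splitAt (suc n) u) (splitAt (suc n) v) ◁ α bound e =
      fromℚ-mono (ℚ.≤-reflexive eq)

theorem17 : Σ[ M ∈ ℕ ] ¬ (Σ[ φ ∈ Sentence M ] (∀ (G : WeightedGraph M) → (G ⊨ φ) ⇔ Realizable G))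
-- The bound 2 admits exactly the weights -1, 0 and 1 that occur in `G n m`.
theorem17 = 2 , λ (φ , defines) →
  let n , n′ , n<n′ , transfer = indistinguishable φ
  in ¬realizable n<n′
       (Equivalence.to (defines (G n n′)) (transfer n′ (Equivalence.from (defines (G n′ n′)) (realizable n′))))
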